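{- Let $s\ge 3$. Then $D'(K_{1,s})=s+1$ and $W'(K_{1,s})=s$.
   Context: Graphs are finite and simple; $K_{1,s}$ is the star with $s$ leaves. First-order sentences are over the vocabulary $\{\sim,=\}$ (adjacency and equality). A first-order sentence $\Phi$ defines a class of graphs $\mathcal C$ asymptotically over connected graphs if there is an integer $N$ such that for every connected graph $G$ with at least $N$ vertices, $G\models\Phi$ iff $G\in\mathcal C$. For a graph $F$, let $\mathcal C_F$ be the class of graphs containing a (not necessarily induced) subgraph isomorphic to $F$. $D'(F)$ is the minimum quantifier depth of a sentence defining $\mathcal C_F$ asymptotically over connected graphs, and $W'(F)$ is the minimum variable width (number of distinct first-order variables used) of such a sentence. -}

module Defs where

open import Data.Nat using (ℕ; zero; suc; _≤_; _≡ᵇ_; _⊔_)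
open import Data.Nat.Properties using (_≟_)
open import Data.Fin using (Fin; zero; suc)
open import Data.Bool using (Bool; true; false; if_then_else_)
open import Data.List using (List; []; _∷_; _++_; filter; length; deduplicate)
open import Data.Product using (Σ; _×_; _,_)
open import Data.Sum using (_⊎_)
open import Data.Empty using (⊥)
open import Relation.Nullary using (¬_; ¬?)
open import Relation.Binary.PropositionalEquality using (_≡_)
open import Function.Definitions using (Injective)
open import Function.Bundles using (_⇔_)

record Graph (n : ℕ) : Set where
  field
    adj    : Fin n → Fin n → Bool
    sym    : ∀ u v → adj u v ≡ adj v u
    irrefl : ∀ v → adj v v ≡ false
open Graph public

_~_within_ : ∀ {n} → Fin n → Fin n → Graph n → Set
u ~ v within G = adj G u v ≡ true

data Reach {n : ℕ} (G : Graph n) : Fin n → Fin n → Set where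
  here : ∀ {u} → Reach G u u
  step : ∀ {u w v} → u ~ w within G → Reach G w v → Reach G u v

Connected : ∀ {n} → Graph n → Set
Connected {n} G = (1 ≤ n) × (∀ u v → Reach G u v)

Contains : ∀ {m n} → Graph m → Graph n → Set
Contains {m} {n} F G =
  Σ (Fin m → Fin n) λ h → Injective _≡_ _≡_ h × (∀ u v → u ~ v within F → h u ~ h v within G)

starAdj : ∀ {s} → Fin (suc s) → Fin (suc s) → Bool
starAdj zero    (suc _) = true
starAdj (suc _) zero    = true
starAdj _       _       = false

starSym : ∀ {s} (u v : Fin (suc s)) → starAdj u v ≡ starAdj v u
starSym zero    zero    = _≡_.refl
starSym zero    (suc _) = _≡_.refl
starSym (suc _) zero    = _≡_.refl
starSym (suc _) (suc _) = _≡_.refl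

starIrr : ∀ {s} (v : Fin (suc s)) → starAdj v v ≡ false
starIrr zero    = _≡_.refl
starIrr (suc _) = _≡_.refl

Star : (s : ℕ) → Graph (suc s)
Star s = record { adj = starAdj ; sym = starSym ; irrefl = starIrr }

Var : Set
Var = ℕ

data Formula : Set where
  adjF  : Var → Var → Formula
  eqF   : Var → Var → Formula
  notF  : Formula → Formula
  andF  : Formula → Formula → Formula
  orF   : Formula → Formula → Formula
  exF   : Var → Formula → Formula
  allF  : Var → Formula → Formula

fv : Formula → List Var
fv (adjF x y) = x ∷ y ∷ []
fv (eqF x y)  = x ∷ y ∷ []
fv (notF φ)   = fv φ
fv (andF φ ψ) = fv φ ++ fv ψ
fv (orF φ ψ)  = fv φ ++ fv ψ
fv (exF x φ)  = filter (λ y → ¬? (x ≟ y)) (fv φ)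
fv (allF x φ) = filter (λ y → ¬? (x ≟ y)) (fv φ)

Sentence : Formula → Set
Sentence φ = fv φ ≡ []

vars : Formula → List Var
vars (adjF x y) = x ∷ y ∷ []
vars (eqF x y)  = x ∷ y ∷ []
vars (notF φ)   = vars φ
vars (andF φ ψ) = vars φ ++ vars ψ
vars (orF φ ψ)  = vars φ ++ vars ψ
vars (exF x φ)  = x ∷ vars φ
vars (allF x φ) = x ∷ vars φ

width : Formula → ℕ
width φ = length (deduplicate _≟_ (vars φ))

qdepth : Formula → ℕ
qdepth (adjF _ _) = 0
qdepth (eqF _ _)  = 0
qdepth (notF φ)   = qdepth φ
qdepth (andF φ ψ) = qdepth φ ⊔ qdepth ψ
qdepth (orF φ ψ)  = qdepth φ ⊔ qdepth ψ
qdepth (exF _ φ)  = suc (qdepth φ)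
qdepth (allF _ φ) = suc (qdepth φ)

update : ∀ {n} → (Var → Fin n) → Var → Fin n → Var → Fin n
update ρ x v y = if x ≡ᵇ y then v else ρ y

Sat : ∀ {n} → Graph n → (Var → Fin n) → Formula → Set
Sat G ρ (adjF x y) = ρ x ~ ρ y within G
Sat G ρ (eqF x y)  = ρ x ≡ ρ y
Sat G ρ (notF φ)   = ¬ Sat G ρ φ
Sat G ρ (andF φ ψ) = Sat G ρ φ × Sat G ρ ψ
Sat G ρ (orF φ ψ)  = Sat G ρ φ ⊎ Sat G ρ ψ
Sat {n} G ρ (exF x φ)  = Σ (Fin n) λ v → Sat G (update ρ x v) φ
Sat {n} G ρ (allF x φ) = (v : Fin n) → Sat G (update ρ x v) φ

-- G ⊨ Φ (for sentences the assignment is irrelevant)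
_⊨_ : ∀ {n} → Graph n → Formula → Set
G ⊨ Φ = ∀ ρ → Sat G ρ Φ

DefinesAsympConn : Formula → (∀ {n} → Graph n → Set) → Set
DefinesAsympConn Φ 𝒞 =
  Σ ℕ λ N → ∀ n (G : Graph n) → Connected G → N ≤ n → (G ⊨ Φ) ⇔ 𝒞 G

𝒞 : ∀ {m} → Graph m → ∀ {n} → Graph n → Set
𝒞 F G = Contains F G

D′≡ : ∀ {m} → Graph m → ℕ → Set
D′≡ F d =
  (Σ Formula λ Φ → Sentence Φ × DefinesAsympConn Φ (𝒞 F) × qdepth Φ ≡ d)
  × (∀ Φ → Sentence Φ → DefinesAsympConn Φ (𝒞 F) → d ≤ qdepth Φ)

W′≡ : ∀ {m} → Graph m → ℕ → Set
W′≡ F w =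
  (Σ Formula λ Φ → Sentence Φ × DefinesAsympConn Φ (𝒞 F) × width Φ ≡ w)
  × (∀ Φ → Sentence Φ → DefinesAsympConn Φ (𝒞 F) → w ≤ width Φ)

{-# OPTIONS --safe #-}

-- Upper bounds: a large connected graph contains K₁,ₛ iff it has s distinct
-- vertices y₀, …, yₛ₋₁ any s − 1 of which have a common neighbour.  For if no
-- vertex had degree ≥ s, the common neighbours would be distinct, and together
-- with the yᵢ they would have all their neighbours among themselves: a component
-- of at most 2s vertices.  This takes s variables and quantifier depth s + 1.
--
-- Lower bounds: compare the spiders with s and with s − 1 long legs.  Duplicator
-- answers at the same height, keeping track of which pebbles share a leg; she
-- finds an unused leg as long as at most s − 2 other pebbles are on the board.
-- This suffices for s − 1 pebbles, and for all of s rounds but the last.  There,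
-- if all s − 1 legs are used, the centre is not pebbled, and any vertex away
-- from all pebbles will do.
module Submission where

open import Defs
open import Data.Bool using (true; false; T)
open import Data.Empty using (⊥-elim)
open import Data.Fin as Fin using (Fin; zero; suc; toℕ; fromℕ<; combine; remQuot)
import Data.Fin.Properties as Fin
open import Data.List using (List; []; _∷_; _++_; map; filter; length; lookup; deduplicate; upTo; tabulate)
open import Data.List.Membership.Propositional using (_∈_; _∉_; find)
open import Data.List.Membership.Propositional.Properties using (∈-++⁺ˡ; ∈-++⁺ʳ; ∈-++⁻; ∈-map⁺; ∈-filter⁺; ∈-filter⁻; ∈-lookup; ∈-tabulate⁺; ∈-upTo⁺; ∈-upTo⁻; ∈-deduplicate⁺; ∈-deduplicate⁻)
open import Data.List.Membership.DecPropositional using (_∈?_)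
import Data.List.Membership.Setoid.Properties as SetoidMembership
open import Data.List.Properties using (length-map; length-++; length-tabulate; length-upTo)
open import Data.List.Relation.Binary.Subset.Propositional using (_⊆_)
open import Data.List.Relation.Unary.All as All using (All; []; _∷_)
import Data.List.Relation.Unary.All.Properties as All
open import Data.List.Relation.Unary.AllPairs using ([]; _∷_)
open import Data.List.Relation.Unary.Any as Any using (any?; here; there; index)
open import Data.List.Relation.Unary.Unique.Propositional using (Unique)
import Data.List.Relation.Unary.Unique.DecPropositional.Properties as Unique
open import Data.Maybe using (Maybe; just; nothing)
import Data.Maybe.Properties as Maybe
open import Data.Nat using (ℕ; zero; suc; pred; _+_; _*_; _≤_; _<_; _≡ᵇ_; z≤n; s≤s; _≤?_; _<?_)
open import Data.Nat.Properties
open import Data.Product using (Σ; ∃-syntax; _×_; _,_; proj₁; proj₂)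
open import Data.Sum as Sum using (_⊎_; inj₁; inj₂; [_,_]′)
open import Data.Unit using (⊤)
open import Function using (_∘_; id)
open import Function.Bundles using (_⇔_; mk⇔; Equivalence)
open import Function.Definitions using (Injective)
open import Relation.Binary.Definitions using (DecidableEquality)
open import Relation.Binary.PropositionalEquality as ≡ using (_≡_; _≢_; refl; cong; cong₂; subst)
open import Relation.Nullary using (¬_; ¬?; Dec; yes; no; does; contradiction)
open import Relation.Nullary.Decidable using (_×-dec_; _⊎-dec_; dec-true; dec-false; does-⇔)

open Equivalence using (to; from)

-- Counting

module _ {A : Set} (_≟ᴬ_ : DecidableEquality A) where

  ∃-fresh : ∀ {n} (f : Fin n → A) → Injective _≡_ _≡_ f →
            (xs : List A) → length xs < n → ∃[ i ] f i ∉ xs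
  ∃-fresh f f-inj xs |xs|<n with Fin.any? (λ i → ¬? (_∈?_ _≟ᴬ_ (f i) xs))
  ... | yes fresh = fresh
  ... | no ¬fresh = contradiction (Fin.injective⇒≤ index-inj) (<⇒≱ |xs|<n)
    where
    f∈xs : ∀ i → f i ∈ xs
    f∈xs i with _∈?_ _≟ᴬ_ (f i) xs
    ... | yes fi∈xs = fi∈xs
    ... | no  fi∉xs = contradiction (i , fi∉xs) ¬fresh

    index-inj : Injective _≡_ _≡_ (λ i → index (f∈xs i))
    index-inj {i} {j} eq =
      f-inj (SetoidMembership.index-injective (≡.setoid A) (f∈xs i) (f∈xs j) eq)

lookup-injective : ∀ {A : Set} {xs : List A} → Unique xs → Injective _≡_ _≡_ (lookup xs)
lookup-injective (_    ∷ _)   {zero}  {zero}  _  = refl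
lookup-injective (x∉xs ∷ _)   {zero}  {suc j} eq = contradiction eq (All.lookup x∉xs (∈-lookup j))
lookup-injective (x∉xs ∷ _)   {suc i} {zero}  eq = contradiction (≡.sym eq) (All.lookup x∉xs (∈-lookup i))
lookup-injective (_    ∷ xs!) {suc i} {suc j} eq = cong suc (lookup-injective xs! eq)

unique-⊆⇒length≤ : {xs ys : List ℕ} → Unique xs → xs ⊆ ys → length xs ≤ length ys
unique-⊆⇒length≤ {xs} {ys} xs! xs⊆ys = ≮⇒≥ λ |ys|<|xs| →
  let i , ∉ys = ∃-fresh _≟_ (lookup xs) (lookup-injective xs!) ys |ys|<|xs|
  in ∉ys (xs⊆ys (∈-lookup i))

-- Formulas

fv⊆vars : ∀ φ → fv φ ⊆ vars φ
fv⊆vars (adjF x y) y∈ = y∈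
fv⊆vars (eqF x y)  y∈ = y∈
fv⊆vars (notF φ)   y∈ = fv⊆vars φ y∈
fv⊆vars (andF φ ψ) y∈ = [ ∈-++⁺ˡ ∘ fv⊆vars φ , ∈-++⁺ʳ (vars φ) ∘ fv⊆vars ψ ]′ (∈-++⁻ (fv φ) y∈)
fv⊆vars (orF φ ψ)  y∈ = [ ∈-++⁺ˡ ∘ fv⊆vars φ , ∈-++⁺ʳ (vars φ) ∘ fv⊆vars ψ ]′ (∈-++⁻ (fv φ) y∈)
fv⊆vars (exF x φ)  y∈ = there (fv⊆vars φ (proj₁ (∈-filter⁻ (λ z → ¬? (x ≟ z)) y∈)))
fv⊆vars (allF x φ) y∈ = there (fv⊆vars φ (proj₁ (∈-filter⁻ (λ z → ¬? (x ≟ z)) y∈)))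

update-≡ : ∀ {n} (ρ : Var → Fin n) x v → update ρ x v x ≡ v
update-≡ ρ x v with x ≡ᵇ x in eq
... | true  = refl
... | false = ⊥-elim (subst T eq (≡⇒≡ᵇ x x refl))

update-≢ : ∀ {n} (ρ : Var → Fin n) {x y} v → x ≢ y → update ρ x v y ≡ ρ y
update-≢ ρ {x} {y} v x≢y with x ≡ᵇ y in eq
... | true  = contradiction (≡ᵇ⇒≡ x y (subst T (≡.sym eq) _)) x≢y
... | false = refl

-- The pebbles that stay on the board while `x` is moved. Repetitions are removed because the length
-- of this list counts pebbles.
fvQ : Var → Formula → List Var
fvQ x φ = deduplicate _≟_ (filter (λ y → ¬? (x ≟ y)) (fv φ))

module _ (x : Var) (φ : Formula) where

  fvQ⁺ : ∀ {y} → y ∈ fv φ → x ≢ y → y ∈ fvQ x φ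
  fvQ⁺ y∈ x≢y = ∈-deduplicate⁺ _≟_ (∈-filter⁺ (λ z → ¬? (x ≟ z)) y∈ x≢y)

  fvQ⊆filter : fvQ x φ ⊆ filter (λ y → ¬? (x ≟ y)) (fv φ)
  fvQ⊆filter = ∈-deduplicate⁻ _≟_ _

  fvQ-unique : Unique (x ∷ fvQ x φ)
  fvQ-unique = All.tabulate (λ y∈ → proj₂ (∈-filter⁻ (λ z → ¬? (x ≟ z)) {xs = fv φ} (fvQ⊆filter y∈)))
             ∷ Unique.deduplicate-! _≟_ _

-- The budget that formulas of quantifier depth s and formulas of width s − 1
-- have in common: with at most s − 2 other free variables every quantifier can
-- be answered, with s − 1 only a last one.
Within : ℕ → Formula → Set
WithinQ : ℕ → Var → Formula → Set

Within s (adjF _ _) = ⊤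
Within s (eqF _ _)  = ⊤
Within s (notF φ)   = Within s φ
Within s (andF φ ψ) = Within s φ × Within s ψ
Within s (orF φ ψ)  = Within s φ × Within s ψ
Within s (exF x φ)  = WithinQ s x φ
Within s (allF x φ) = WithinQ s x φ

WithinQ s x φ = (2 + length (fvQ x φ) ≤ s × Within s φ) ⊎ (1 + length (fvQ x φ) ≤ s × qdepth φ ≤ 0)

-- The quantified variable and the other free ones are distinct members of `X`, so the others number
-- at most `s` - 2 and the first alternative always applies.
width⇒within : ∀ {s} (X : List Var) → length X < s → ∀ φ → vars φ ⊆ X → Within s φ
width⇒withinQ : ∀ {s} (X : List Var) → length X < s → ∀ x φ → x ∷ vars φ ⊆ X → WithinQ s x φ

width⇒within X |X|<s (adjF x y) _ = _
width⇒within X |X|<s (eqF x y)  _ = _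
width⇒within X |X|<s (notF φ)   ⊆X = width⇒within X |X|<s φ ⊆X
width⇒within X |X|<s (andF φ ψ) ⊆X =
  width⇒within X |X|<s φ (⊆X ∘ ∈-++⁺ˡ) , width⇒within X |X|<s ψ (⊆X ∘ ∈-++⁺ʳ (vars φ))
width⇒within X |X|<s (orF φ ψ)  ⊆X =
  width⇒within X |X|<s φ (⊆X ∘ ∈-++⁺ˡ) , width⇒within X |X|<s ψ (⊆X ∘ ∈-++⁺ʳ (vars φ))
width⇒within X |X|<s (exF x φ)  ⊆X = width⇒withinQ X |X|<s x φ ⊆X
width⇒within X |X|<s (allF x φ) ⊆X = width⇒withinQ X |X|<s x φ ⊆X

width⇒withinQ X |X|<s x φ ⊆X = inj₁
  ( ≤-trans (s≤s (unique-⊆⇒length≤ (fvQ-unique x φ) fv⊆X)) |X|<s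
  , width⇒within X |X|<s φ (⊆X ∘ there) )
  where
  fv⊆X : x ∷ fvQ x φ ⊆ X
  fv⊆X (here refl) = ⊆X (here refl)
  fv⊆X (there y∈)  = ⊆X (fv⊆vars (exF x φ) (fvQ⊆filter x φ y∈))

-- `X` holds the variables bound so far, and each quantifier trades one unit of depth for one more
-- variable. A quantifier above another one has a unit of depth to spare, which gives the stronger
-- bound on the free variables.
qdepth⇒within : ∀ {s} φ (X : List Var) → fv φ ⊆ X → length X + qdepth φ ≤ s → Within s φ
qdepth⇒withinQ : ∀ {s} x φ (X : List Var) → fv (exF x φ) ⊆ X → length X + suc (qdepth φ) ≤ s → WithinQ s x φ

qdepth⇒within (adjF x y) X ⊆X ≤s = _
qdepth⇒within (eqF x y)  X ⊆X ≤s = _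
qdepth⇒within (notF φ)   X ⊆X ≤s = qdepth⇒within φ X ⊆X ≤s
qdepth⇒within (andF φ ψ) X ⊆X ≤s =
  qdepth⇒within φ X (⊆X ∘ ∈-++⁺ˡ) (≤-trans (+-monoʳ-≤ (length X) (m≤m⊔n _ _)) ≤s) ,
  qdepth⇒within ψ X (⊆X ∘ ∈-++⁺ʳ (fv φ)) (≤-trans (+-monoʳ-≤ (length X) (m≤n⊔m (qdepth φ) _)) ≤s)
qdepth⇒within (orF φ ψ)  X ⊆X ≤s =
  qdepth⇒within φ X (⊆X ∘ ∈-++⁺ˡ) (≤-trans (+-monoʳ-≤ (length X) (m≤m⊔n _ _)) ≤s) ,
  qdepth⇒within ψ X (⊆X ∘ ∈-++⁺ʳ (fv φ)) (≤-trans (+-monoʳ-≤ (length X) (m≤n⊔m (qdepth φ) _)) ≤s)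
qdepth⇒within (exF x φ)  X ⊆X ≤s = qdepth⇒withinQ x φ X ⊆X ≤s
qdepth⇒within (allF x φ) X ⊆X ≤s = qdepth⇒withinQ x φ X ⊆X ≤s

qdepth⇒withinQ {s} x φ X ⊆X ≤s with qdepth φ ≤? 0 | Unique.deduplicate-! _≟_ (fv (exF x φ))
... | yes qf | fvQ! = inj₂ (≤-trans (s≤s |fv|≤|X|) (≤-trans (s≤s (m≤m+n _ (qdepth φ))) |X|+d<s) , qf)
  where
  |fv|≤|X| = unique-⊆⇒length≤ fvQ! (⊆X ∘ fvQ⊆filter x φ)
  |X|+d<s = subst (_≤ s) (+-suc (length X) (qdepth φ)) ≤s
... | no ¬qf | fvQ! = inj₁ (≤-trans (s≤s |fv|<|X|+d) |X|+d<s , qdepth⇒within φ (x ∷ X) fv⊆x∷X |X|+d<s)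
  where
  |X|+d<s = subst (_≤ s) (+-suc (length X) (qdepth φ)) ≤s
  |fv|<|X|+d = ≤-trans (s≤s (unique-⊆⇒length≤ fvQ! (⊆X ∘ fvQ⊆filter x φ)))
                 (≤-trans (≤-reflexive (+-comm 1 (length X))) (+-monoʳ-≤ (length X) (≰⇒> ¬qf)))
  fv⊆x∷X : fv φ ⊆ x ∷ X
  fv⊆x∷X {y} y∈ with x ≟ y
  ... | yes refl = here refl
  ... | no  x≢y  = there (⊆X (∈-filter⁺ (λ z → ¬? (x ≟ z)) y∈ x≢y))

-- Transfer of satisfaction between two graphs

¬-cong-⇔ : {P Q : Set} → P ⇔ Q → (¬ P) ⇔ (¬ Q)
¬-cong-⇔ P⇔Q = mk⇔ (_∘ from P⇔Q) (_∘ to P⇔Q)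

×-cong-⇔ : {P Q R S : Set} → P ⇔ Q → R ⇔ S → (P × R) ⇔ (Q × S)
×-cong-⇔ e f = mk⇔ (λ (p , r) → to e p , to f r) (λ (q , s) → from e q , from f s)

⊎-cong-⇔ : {P Q R S : Set} → P ⇔ Q → R ⇔ S → (P ⊎ R) ⇔ (Q ⊎ S)
⊎-cong-⇔ e f = mk⇔ (Sum.map (to e) (to f)) (Sum.map (from e) (from f))

module _ {A B : Set} {P : A → Set} {Q : B → Set} (R : A → B → Set)
         (R⇒⇔ : ∀ {v w} → R v w → P v ⇔ Q w)
         (forth : ∀ v → ∃[ w ] R v w) (back : ∀ w → ∃[ v ] R v w) where

  back-and-forth : (Σ A P ⇔ Σ B Q) × ((∀ v → P v) ⇔ (∀ w → Q w))
  back-and-forth =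
    mk⇔ (λ (v , p) → let w , r = forth v in w , to (R⇒⇔ r) p)
        (λ (w , q) → let v , r = back w in v , from (R⇒⇔ r) q) ,
    mk⇔ (λ p w → let v , r = back w in to (R⇒⇔ r) (p v))
        (λ q v → let w , r = forth v in from (R⇒⇔ r) (q w))

-- Comparing pebbles two at a time suffices, since atomic formulas are binary.
On : ∀ {m n} (R : Fin m → Fin n → Fin m → Fin n → Set) →
     List Var → (Var → Fin m) → (Var → Fin n) → Set
On R xs ρ σ = ∀ {y z} → y ∈ xs → z ∈ xs → R (ρ y) (σ y) (ρ z) (σ z)

-- The former value of `x` drops out: the old condition is asked only of the other free variables,
-- so a requantified variable does not count as a pebble.
On-update : ∀ {m n} {R : Fin m → Fin n → Fin m → Fin n → Set} →
  (∀ {u u′ v v′} → R u u′ v v′ → R v v′ u u′) →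
  ∀ x φ {ρ σ v w} → On R (fvQ x φ) ρ σ → R v w v w →
  (∀ {y} → y ∈ fvQ x φ → R v w (ρ y) (σ y)) →
  On R (fv φ) (update ρ x v) (update σ x w)
On-update R-sym x φ {ρ} {σ} {v} {w} old new mixed {y} {z} y∈ z∈ with x ≟ y | x ≟ z
... | yes refl | yes refl rewrite update-≡ ρ x v | update-≡ σ x w = new
... | yes refl | no x≢z
  rewrite update-≡ ρ x v | update-≡ σ x w | update-≢ ρ v x≢z | update-≢ σ w x≢z =
  mixed (fvQ⁺ x φ z∈ x≢z)
... | no x≢y | yes refl
  rewrite update-≡ ρ x v | update-≡ σ x w | update-≢ ρ v x≢y | update-≢ σ w x≢y =
  R-sym (mixed (fvQ⁺ x φ y∈ x≢y))
... | no x≢y | no x≢z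
  rewrite update-≢ ρ v x≢y | update-≢ σ w x≢y | update-≢ ρ v x≢z | update-≢ σ w x≢z =
  old (fvQ⁺ x φ y∈ x≢y) (fvQ⁺ x φ z∈ x≢z)

module _ {m n : ℕ} (G : Graph m) (H : Graph n) where

  Iso : Fin m → Fin n → Fin m → Fin n → Set
  Iso u u′ v v′ = (u ≡ v ⇔ u′ ≡ v′) × (u ~ v within G ⇔ u′ ~ v′ within H)

  Iso-sym : ∀ {u u′ v v′} → Iso u u′ v v′ → Iso v v′ u u′
  Iso-sym {u} {u′} {v} {v′} (eq , ad) =
    mk⇔ (≡.sym ∘ to eq ∘ ≡.sym) (≡.sym ∘ from eq ∘ ≡.sym) ,
    mk⇔ (≡.trans (sym H v′ u′) ∘ to ad ∘ ≡.trans (sym G u v))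
        (≡.trans (sym G v u) ∘ from ad ∘ ≡.trans (sym H u′ v′))

  Iso-diagonal : ∀ {u u′} → Iso u u′ u u′
  Iso-diagonal {u} {u′} = mk⇔ (λ _ → refl) (λ _ → refl) ,
    mk⇔ (λ u~u → contradiction (≡.trans (≡.sym u~u) (irrefl G u)) λ ())
        (λ u~u → contradiction (≡.trans (≡.sym u~u) (irrefl H u′)) λ ())

  -- After the last round a partial isomorphism is enough, so Duplicator may give up her finer
  -- invariant there.
  quantifier-free-transfer : ∀ φ {ρ σ} → qdepth φ ≤ 0 → On Iso (fv φ) ρ σ → Sat G ρ φ ⇔ Sat H σ φ
  quantifier-free-transfer (adjF x y) _ iso = proj₂ (iso (here refl) (there (here refl)))
  quantifier-free-transfer (eqF x y)  _ iso = proj₁ (iso (here refl) (there (here refl)))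
  quantifier-free-transfer (notF φ) qf iso = ¬-cong-⇔ (quantifier-free-transfer φ qf iso)
  quantifier-free-transfer (andF φ ψ) qf iso = ×-cong-⇔
    (quantifier-free-transfer φ (m⊔n≤o⇒m≤o _ _ qf) λ y z → iso (∈-++⁺ˡ y) (∈-++⁺ˡ z))
    (quantifier-free-transfer ψ (m⊔n≤o⇒n≤o _ _ qf) λ y z → iso (∈-++⁺ʳ (fv φ) y) (∈-++⁺ʳ (fv φ) z))
  quantifier-free-transfer (orF φ ψ) qf iso = ⊎-cong-⇔
    (quantifier-free-transfer φ (m⊔n≤o⇒m≤o _ _ qf) λ y z → iso (∈-++⁺ˡ y) (∈-++⁺ˡ z))
    (quantifier-free-transfer ψ (m⊔n≤o⇒n≤o _ _ qf) λ y z → iso (∈-++⁺ʳ (fv φ) y) (∈-++⁺ʳ (fv φ) z))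

-- Spiders

reach-trans : ∀ {n} {G : Graph n} {u v w} → Reach G u v → Reach G v w → Reach G u w
reach-trans here       q = q
reach-trans (step e p) q = step e (reach-trans p q)

reach-sym : ∀ {n} {G : Graph n} {u v} → Reach G u v → Reach G v u
reach-sym here = here
reach-sym {G = G} (step {u} {w} e p) = reach-trans (reach-sym p) (step (≡.trans (sym G w u) e) here)

dec-true⁻ : {P : Set} (P? : Dec P) → does P? ≡ true → P
dec-true⁻ (yes p) _ = p

≡suc⇒≢0 : ∀ {k n} → k ≡ suc n → k ≢ 0
≡suc⇒≢0 refl ()

module Spiders (L : ℕ) where

  -- Vertex `zero` is the centre; every other one encodes a leg together with a position among the
  -- `L` vertices of that leg.
  V : ℕ → Set
  V m = Fin (suc (m * L))

  leg : ∀ m → V m → Maybe (Fin m)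
  leg m zero    = nothing
  leg m (suc k) = just (proj₁ (remQuot {m} L k))

  height : ∀ m → V m → ℕ
  height m zero    = 0
  height m (suc k) = suc (toℕ (proj₂ (remQuot {m} L k)))

  at : ∀ m → Fin m → Fin L → V m
  at m i h = suc (combine i h)

  leg-at : ∀ m i h → leg m (at m i h) ≡ just i
  leg-at m i h = cong (just ∘ proj₁) (Fin.remQuot-combine {m} i h)

  height-at : ∀ m i h → height m (at m i h) ≡ suc (toℕ h)
  height-at m i h = cong (suc ∘ toℕ ∘ proj₂) (Fin.remQuot-combine {m} i h)

  leg-height-injective : ∀ m {u v} → leg m u ≡ leg m v → height m u ≡ height m v → u ≡ v
  leg-height-injective m {zero}  {zero}  _ _ = refl
  leg-height-injective m {suc j} {suc k} l h = cong suc (≡.trans (≡.sym (Fin.combine-remQuot {m} L j))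
    (≡.trans (cong₂ combine (Maybe.just-injective l) (Fin.toℕ-injective (suc-injective h)))
             (Fin.combine-remQuot {m} L k)))

  data View m (v : V m) : Set where
    centre : leg m v ≡ nothing → height m v ≡ 0 → View m v
    on-leg : ∀ i (h : Fin L) → leg m v ≡ just i → height m v ≡ suc (toℕ h) → View m v

  view : ∀ m v → View m v
  view m zero    = centre refl refl
  view m (suc k) = on-leg _ _ refl refl

  -- Stated through heights and legs alone, so that preserving heights and coincidence of legs
  -- preserves adjacency. The second factor lets the centre, which has no leg, neighbour every leg.
  Adj : ∀ m → V m → V m → Set
  Adj m u v = (height m u ≡ suc (height m v) ⊎ height m v ≡ suc (height m u))
            × (height m u ≡ 0 ⊎ height m v ≡ 0 ⊎ leg m u ≡ leg m v)

  Adj? : ∀ m u v → Dec (Adj m u v)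
  Adj? m u v = (height m u ≟ suc (height m v) ⊎-dec height m v ≟ suc (height m u))
         ×-dec (height m u ≟ 0 ⊎-dec height m v ≟ 0 ⊎-dec Maybe.≡-dec Fin._≟_ (leg m u) (leg m v))

  Adj-sym : ∀ m {u v} → Adj m u v → Adj m v u
  Adj-sym m (h , l) = Sum.swap h , [ inj₂ ∘ inj₁ , [ inj₁ , inj₂ ∘ inj₂ ∘ ≡.sym ]′ ]′ l

  Spider : ∀ m → Graph (suc (m * L))
  Spider m = record
    { adj    = λ u v → does (Adj? m u v)
    ; sym    = λ u v → does-⇔ (mk⇔ (Adj-sym m) (Adj-sym m)) (Adj? m u v) (Adj? m v u)
    ; irrefl = λ v → dec-false (Adj? m v v) λ (h , _) → [ m≢1+n+m _ {0} , m≢1+n+m _ {0} ]′ h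
    }

  ~⇔Adj : ∀ m u v → u ~ v within Spider m ⇔ Adj m u v
  ~⇔Adj m u v = mk⇔ (dec-true⁻ (Adj? m u v)) (dec-true (Adj? m u v))

  -- Walk out along the leg; `k` carries the recursion because the predecessor of `h` is a new
  -- element of `Fin L` rather than a subterm.
  centre-reach : ∀ m i h {k} → toℕ h ≡ k → Reach (Spider m) zero (at m i h)
  centre-reach m i h {zero} h≡0 = step (from (~⇔Adj m _ _)
    (inj₂ (≡.trans (height-at m i h) (cong suc h≡0)) , inj₁ refl)) here
  centre-reach m i h {suc k} h≡1+k = reach-trans (centre-reach m i h′ toℕ-h′)
    (step (from (~⇔Adj m _ _)
      ( inj₂ (≡.trans (height-at m i h) (cong suc (≡.trans h≡1+k (≡.sym (≡.trans (height-at m i h′) (cong suc toℕ-h′))))))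
      , inj₂ (inj₂ (≡.trans (leg-at m i h′) (≡.sym (leg-at m i h)))))) here)
    where
    k<L : k < L
    k<L = <-trans (n<1+n k) (subst (_< L) h≡1+k (Fin.toℕ<n h))
    h′ = fromℕ< k<L
    toℕ-h′ = Fin.toℕ-fromℕ< k<L

  Spider-connected : ∀ m → Connected (Spider m)
  Spider-connected m = s≤s z≤n , λ u v → reach-trans (reach-sym (reach u)) (reach v)
    where
    reach : ∀ v → Reach (Spider m) zero v
    reach zero    = here
    reach (suc k) = subst (λ j → Reach (Spider m) zero (suc j)) (Fin.combine-remQuot {m} L k)
                          (centre-reach m _ _ refl)

  Spider-∋-Star : ∀ s → 0 < L → Contains (Star s) (Spider s)
  Spider-∋-Star s 0<L = f , f-injective , f-hom
    where
    h₀ = fromℕ< 0<L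
    f : Fin (suc s) → V s
    f zero    = zero
    f (suc i) = at s i h₀
    f-injective : Injective _≡_ _≡_ f
    f-injective {zero}  {zero}  _  = refl
    f-injective {suc i} {suc j} eq = cong suc (Maybe.just-injective
      (≡.trans (≡.sym (leg-at s i h₀)) (≡.trans (cong (leg s) eq) (leg-at s j h₀))))
    spoke : ∀ i → Adj s zero (at s i h₀)
    spoke i = inj₂ (≡.trans (height-at s i h₀) (cong suc (Fin.toℕ-fromℕ< 0<L))) , inj₁ refl
    f-hom : ∀ u v → u ~ v within Star s → f u ~ f v within Spider s
    f-hom zero    (suc j) _ = from (~⇔Adj s _ _) (spoke j)
    f-hom (suc i) zero    _ = from (~⇔Adj s _ _) (Adj-sym s (spoke i))

  -- The centre has one neighbour on each of the `m` legs. Any other vertex has at most two, one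
  -- nearer to the centre and one farther, and 2 ≤ `m` < `s`.
  Spider-∌-Star : ∀ {s} m → 2 ≤ m → m < s → ¬ Contains (Star s) (Spider m)
  Spider-∌-Star {s} m 2≤m m<s (f , f-inj , f-hom) with view m (f zero)
  ... | centre _ h≡0 = contradiction (Fin.injective⇒≤ inj) (<⇒≱ m<s)
    where
    nbr : ∀ j → height m (f (suc j)) ≡ 1
    nbr j with proj₁ (to (~⇔Adj m _ _) (f-hom zero (suc j) refl))
    ... | inj₁ e = contradiction h≡0 (≡suc⇒≢0 e)
    ... | inj₂ e = ≡.trans e (cong suc h≡0)
    legOf : ∀ j → ∃[ i ] leg m (f (suc j)) ≡ just i
    legOf j with view m (f (suc j))
    ... | centre _ h   = contradiction h (≡suc⇒≢0 (nbr j))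
    ... | on-leg i _ l _ = i , l
    inj : Injective _≡_ _≡_ (λ j → proj₁ (legOf j))
    inj {i} {j} eq = Fin.suc-injective (f-inj (leg-height-injective m
      (≡.trans (proj₂ (legOf i)) (≡.trans (cong just eq) (≡.sym (proj₂ (legOf j)))))
      (≡.trans (nbr i) (≡.sym (nbr j)))))
  ... | on-leg i h l≡i h≡1+h = contradiction (Fin.injective⇒≤ inj) (<⇒≱ (≤-<-trans 2≤m m<s))
    where
    nbr : ∀ j → Adj m (f zero) (f (suc j))
    nbr j = to (~⇔Adj m _ _) (f-hom zero (suc j) refl)
    side : Fin s → Fin 2
    side j with proj₁ (nbr j)
    ... | inj₁ _ = zero
    ... | inj₂ _ = suc zero
    side⇒height : ∀ j k → side j ≡ side k → height m (f (suc j)) ≡ height m (f (suc k))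
    side⇒height j k eq with proj₁ (nbr j) | proj₁ (nbr k)
    ... | inj₁ p | inj₁ q = suc-injective (≡.trans (≡.sym p) q)
    ... | inj₂ p | inj₂ q = ≡.trans p (≡.sym q)
    -- Equal heights put both neighbours at the centre or neither; in the latter case both lie on
    -- the leg of `f zero`.
    side⇒leg : ∀ j k → height m (f (suc j)) ≡ height m (f (suc k)) → leg m (f (suc j)) ≡ leg m (f (suc k))
    side⇒leg j k eq with view m (f (suc j)) | view m (f (suc k)) | proj₂ (nbr j) | proj₂ (nbr k)
    ... | centre l _ | centre l′ _ | _ | _ = ≡.trans l (≡.sym l′)
    ... | centre _ p | on-leg _ _ _ q | _ | _ = contradiction (≡.trans (≡.sym eq) p) (≡suc⇒≢0 q)
    ... | on-leg _ _ _ q | centre _ p | _ | _ = contradiction (≡.trans eq p) (≡suc⇒≢0 q)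
    ... | on-leg _ _ _ p | on-leg _ _ _ q | inj₂ (inj₂ l) | inj₂ (inj₂ l′) = ≡.trans (≡.sym l) l′
    ... | on-leg _ _ _ p | on-leg _ _ _ q | inj₁ z | _ = contradiction z (≡suc⇒≢0 h≡1+h)
    ... | on-leg _ _ _ p | on-leg _ _ _ q | inj₂ _ | inj₁ z = contradiction z (≡suc⇒≢0 h≡1+h)
    ... | on-leg _ _ _ p | on-leg _ _ _ q | inj₂ (inj₁ z) | inj₂ _ = contradiction z (≡suc⇒≢0 p)
    ... | on-leg _ _ _ p | on-leg _ _ _ q | inj₂ (inj₂ _) | inj₂ (inj₁ z) = contradiction z (≡suc⇒≢0 q)
    inj : Injective _≡_ _≡_ side
    inj {j} {k} eq = let h = side⇒height j k eq in
      Fin.suc-injective (f-inj (leg-height-injective m (side⇒leg j k h) h))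

  -- Duplicator's invariant and her answers on two spiders

  Match : ∀ a b → V a → V b → V a → V b → Set
  Match a b u u′ v v′ = height a u ≡ height b u′ × height a v ≡ height b v′
                      × (leg a u ≡ leg a v ⇔ leg b u′ ≡ leg b v′)

  Match-sym : ∀ a b {u u′ v v′} → Match a b u u′ v v′ → Match a b v v′ u u′
  Match-sym a b (hu , hv , l) = hv , hu , mk⇔ (≡.sym ∘ to l ∘ ≡.sym) (≡.sym ∘ from l ∘ ≡.sym)

  Match-flip : ∀ a b {u u′ v v′} → Match a b u u′ v v′ → Match b a u′ u v′ v
  Match-flip a b (hu , hv , l) = ≡.sym hu , ≡.sym hv , mk⇔ (from l) (to l)

  -- A vertex is determined by its leg and height, and adjacency by heights and coincidence of legs,
  -- the centre being recognised by height 0. One direction suffices, as `Match` survives exchanging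
  -- the spiders.
  Match⇒ : ∀ a b {u u′ v v′} → Match a b u u′ v v′ → (u ≡ v → u′ ≡ v′) × (Adj a u v → Adj b u′ v′)
  Match⇒ a b {u} {u′} {v} {v′} (hu , hv , l) =
    (λ u≡v → leg-height-injective b (to l (cong (leg a) u≡v))
               (≡.trans (≡.sym hu) (≡.trans (cong (height a) u≡v) hv))) ,
    (λ (h , z) →
      Sum.map (λ e → ≡.trans (≡.sym hu) (≡.trans e (cong suc hv)))
              (λ e → ≡.trans (≡.sym hv) (≡.trans e (cong suc hu))) h ,
      Sum.map (≡.trans (≡.sym hu)) (Sum.map (≡.trans (≡.sym hv)) (to l)) z)

  mk-Iso : ∀ a b {u u′ v v′} → (u ≡ v ⇔ u′ ≡ v′) → (Adj a u v ⇔ Adj b u′ v′) → Iso (Spider a) (Spider b) u u′ v v′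
  mk-Iso a b eq ad = eq ,
    mk⇔ (from (~⇔Adj b _ _) ∘ to ad ∘ to (~⇔Adj a _ _)) (from (~⇔Adj a _ _) ∘ from ad ∘ to (~⇔Adj b _ _))

  Match⇒Iso : ∀ a b {u u′ v v′} → Match a b u u′ v v′ → Iso (Spider a) (Spider b) u u′ v v′
  Match⇒Iso a b {u} {u′} {v} {v′} match =
    let eq→ , ad→ = Match⇒ a b {u} {u′} {v} {v′} match
        eq← , ad← = Match⇒ b a {u′} {u} {v′} {v} (Match-flip a b {u} {u′} {v} {v′} match)
    in mk-Iso a b (mk⇔ eq→ eq←) (mk⇔ ad→ ad←)

  record Extends a b (xs : List Var) (ρ : Var → V a) (σ : Var → V b) (v : V a) (w : V b) : Set where
    constructor extends
    field
      height-≡ : height a v ≡ height b w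
      leg-⇔    : ∀ {y} → y ∈ xs → leg a v ≡ leg a (ρ y) ⇔ leg b w ≡ leg b (σ y)
  open Extends

  Extends-flip : ∀ {a b xs ρ σ v w} → Extends a b xs ρ σ v w → Extends b a xs σ ρ w v
  Extends-flip e = extends (≡.sym (height-≡ e)) λ y∈ → mk⇔ (from (leg-⇔ e y∈)) (to (leg-⇔ e y∈))

  On-flip : ∀ a b {xs ρ σ} → On (Match a b) xs ρ σ → On (Match b a) xs σ ρ
  On-flip a b {ρ = ρ} {σ} match {y} {z} y∈ z∈ =
    Match-flip a b {ρ y} {σ y} {ρ z} {σ z} (match y∈ z∈)

  Extends⇒Match : ∀ a b {xs ρ σ v w} → On (Match a b) xs ρ σ → Extends a b xs ρ σ v w →
                  ∀ {y} → y ∈ xs → Match a b v w (ρ y) (σ y)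
  Extends⇒Match a b match e y∈ = height-≡ e , proj₁ (match y∈ y∈) , leg-⇔ e y∈

  height-≡⇒leg-nothing : ∀ a b {u v} → height a u ≡ height b v → leg a u ≡ nothing → leg b v ≡ nothing
  height-≡⇒leg-nothing a b {zero} {zero} _ _ = refl

  data Extension a b xs ρ σ (v : V a) : Set where
    old-leg : ∀ {w} → Extends a b xs ρ σ v w → Extension a b xs ρ σ v
    new-leg : (h : Fin L) → height a v ≡ suc (toℕ h) →
              (∀ {y} → y ∈ xs → leg a v ≢ leg a (ρ y)) → Extension a b xs ρ σ v

  extension : ∀ a b {xs ρ σ} → On (Match a b) xs ρ σ → ∀ v → Extension a b xs ρ σ v
  extension a b {xs} {ρ} {σ} match v with view a v
  ... | centre l≡ h≡ = old-leg {w = zero} (extends h≡ λ {y} y∈ → mk⇔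
          (λ eq → ≡.sym (height-≡⇒leg-nothing a b (proj₁ (match y∈ y∈)) (≡.trans (≡.sym eq) l≡)))
          (λ eq → ≡.trans l≡ (≡.sym (height-≡⇒leg-nothing b a (≡.sym (proj₁ (match y∈ y∈))) (≡.sym eq)))))
  ... | on-leg i h l≡ h≡ with any? (λ y → Maybe.≡-dec Fin._≟_ (leg a v) (leg a (ρ y))) xs
  ... | no unused = new-leg h h≡ λ y∈ eq → unused (Any.map (λ { refl → eq }) y∈)
  ... | yes used with find used
  ... | z , z∈ , v-z with view b (σ z)
  -- `σ z` cannot be the centre, since then `ρ z` would be too, although it shares the leg of `v`.
  ... | centre l _ = contradiction
          (≡.trans (≡.sym l≡) (≡.trans v-z (height-≡⇒leg-nothing b a (≡.sym (proj₁ (match z∈ z∈))) l))) λ ()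
  -- The answer sits on the leg of `σ z` at the height of `v`; comparisons with the other pebbles
  -- pass through `z`.
  ... | on-leg j _ l _ = old-leg {w = at b j h} (extends (≡.trans h≡ (≡.sym (height-at b j h))) λ y∈ →
          let w-z = ≡.trans (leg-at b j h) (≡.sym l)
              z-y = proj₂ (proj₂ (match z∈ y∈)) in mk⇔
          (λ eq → ≡.trans w-z (to z-y (≡.trans (≡.sym v-z) eq)))
          (λ eq → ≡.trans v-z (from z-y (≡.trans (≡.sym w-z) eq))))

  -- Both sides of every leg comparison are false: each of the two legs is free of pebbles in its
  -- own spider.
  extends-new-leg : ∀ a b {xs ρ σ v} (h : Fin L) → height a v ≡ suc (toℕ h) →
    (∀ {y} → y ∈ xs → leg a v ≢ leg a (ρ y)) → ∀ j → just j ∉ map (leg b ∘ σ) xs →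
    Extends a b xs ρ σ v (at b j h)
  extends-new-leg a b {σ = σ} h h≡ unused j j∉ = extends (≡.trans h≡ (≡.sym (height-at b j h))) λ {y} y∈ → mk⇔
    (λ eq → contradiction eq (unused y∈))
    (λ eq → contradiction (subst (_∈ _) (≡.trans (≡.sym eq) (leg-at b j h)) (∈-map⁺ (leg b ∘ σ) y∈)) j∉)

  extend : ∀ a b {xs ρ σ} → On (Match a b) xs ρ σ → length xs < b → ∀ v → ∃[ w ] Extends a b xs ρ σ v w
  extend a b {xs} {ρ} {σ} match |xs|<b v with extension a b match v
  ... | old-leg e = _ , e
  ... | new-leg h h≡ unused =
    let j , j∉ = ∃-fresh (Maybe.≡-dec Fin._≟_) just Maybe.just-injective (map (leg b ∘ σ) xs)
                   (subst (_< b) (≡.sym (length-map _ xs)) |xs|<b)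
    in _ , extends-new-leg a b h h≡ unused j j∉

  IsoTo : ∀ a b → List Var → (Var → V a) → (Var → V b) → V a → V b → Set
  IsoTo a b xs ρ σ v w = ∀ {y} → y ∈ xs → Iso (Spider a) (Spider b) v w (ρ y) (σ y)

  IsoTo-flip : ∀ a b {xs ρ σ v w} → IsoTo a b xs ρ σ v w → IsoTo b a xs σ ρ w v
  IsoTo-flip a b iso y∈ = let eq , ad = iso y∈ in mk⇔ (from eq) (to eq) , mk⇔ (from ad) (to ad)

  -- When every leg of the second spider is occupied and its centre is not, a
  -- vertex on an unoccupied leg of the first is isolated from all chosen ones;
  -- legs are long enough to contain a vertex isolated from all chosen ones too.
  extend-last : ∀ a b {xs ρ σ} → On (Match a b) xs ρ σ → 1 ≤ b → length xs ≤ b →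
    length xs + (length xs + length xs) < L → ∀ v → ∃[ w ] IsoTo a b xs ρ σ v w
  extend-last a b {xs} {ρ} {σ} match 1≤b |xs|≤b 3|xs|<L v with extension a b match v
  ... | old-leg e = _ , λ y∈ → Match⇒Iso a b (Extends⇒Match a b match e y∈)
  ... | new-leg h h≡ unused
    with ∃-fresh (Maybe.≡-dec Fin._≟_) place place-injective (map (leg b ∘ σ) xs)
           (subst (_< suc b) (≡.sym (length-map _ xs)) (s≤s |xs|≤b))
    where
    -- The centre counts as one more place beside the `b` legs: `b` + 1 places against at most `b`
    -- pebbles, so one is unoccupied.
    place : Fin (suc b) → Maybe (Fin b)
    place zero    = nothing
    place (suc i) = just i
    place-injective : Injective _≡_ _≡_ place
    place-injective {zero}  {zero}  _    = refl
    place-injective {suc i} {suc j} refl = refl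
  ... | suc j , j∉ = _ , λ y∈ → Match⇒Iso a b (Extends⇒Match a b match (extends-new-leg a b h h≡ unused j j∉) y∈)
  ... | zero , centre∉ = w , λ y∈ → mk-Iso a b
          (mk⇔ (λ eq → contradiction (cong (leg a) eq) (unused y∈)) (λ eq → contradiction eq (w≢ y∈)))
          (mk⇔ (λ ad → contradiction ad (v≁ y∈)) (λ ad → contradiction ad (w≁ y∈)))
    where
    p = height b ∘ σ
    -- The heights at which `w` could equal a pebbled vertex or be adjacent to one: three per
    -- pebble, hence the bound on `L`.
    near = map p xs ++ (map (suc ∘ p) xs ++ map (pred ∘ p) xs)
    |near| : length near ≡ length xs + (length xs + length xs)
    |near| = ≡.trans (length-++ (map p xs)) (cong₂ _+_ (length-map _ xs)
               (≡.trans (length-++ (map (suc ∘ p) xs)) (cong₂ _+_ (length-map _ xs) (length-map _ xs))))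
    free = ∃-fresh _≟_ (suc ∘ toℕ) (Fin.toℕ-injective ∘ suc-injective) near
             (subst (_< L) (≡.sym |near|) 3|xs|<L)
    w = at b (fromℕ< 1≤b) (proj₁ free)
    w∉near : height b w ∉ near
    w∉near = subst (_∉ near) (≡.sym (height-at b _ (proj₁ free))) (proj₂ free)
    w≢ : ∀ {y} → y ∈ xs → w ≢ σ y
    w≢ y∈ eq = w∉near (∈-++⁺ˡ (subst (_∈ map p xs) (cong (height b) (≡.sym eq)) (∈-map⁺ p y∈)))
    w≁ : ∀ {y} → y ∈ xs → ¬ Adj b w (σ y)
    w≁ y∈ (inj₁ e , _) = w∉near (∈-++⁺ʳ (map p xs) (∈-++⁺ˡ
      (subst (_∈ map (suc ∘ p) xs) (≡.sym e) (∈-map⁺ (suc ∘ p) y∈))))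
    w≁ y∈ (inj₂ e , _) = w∉near (∈-++⁺ʳ (map p xs) (∈-++⁺ʳ (map (suc ∘ p) xs)
      (subst (_∈ map (pred ∘ p) xs) (cong pred e) (∈-map⁺ (pred ∘ p) y∈))))
    ρ-off-centre : ∀ {y} → y ∈ xs → height a (ρ y) ≢ 0
    ρ-off-centre {y} y∈ h≡0 with view b (σ y)
    ... | centre l _     = centre∉ (subst (_∈ _) l (∈-map⁺ (leg b ∘ σ) y∈))
    ... | on-leg _ _ _ e = ≡suc⇒≢0 e (≡.trans (≡.sym (proj₁ (match y∈ y∈))) h≡0)
    v≁ : ∀ {y} → y ∈ xs → ¬ Adj a v (ρ y)
    v≁ y∈ (_ , inj₁ z)        = ≡suc⇒≢0 h≡ z
    v≁ y∈ (_ , inj₂ (inj₁ z)) = ρ-off-centre y∈ z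
    v≁ y∈ (_ , inj₂ (inj₂ l)) = unused y∈ l

  -- Agreement of two spiders on formulas within the budget

  module _ {s : ℕ} (a b : ℕ) (1≤a : 1 ≤ a) (1≤b : 1 ≤ b) (s≤1+a : s ≤ suc a) (s≤1+b : s ≤ suc b)
           (3s≤L : s + (s + s) ≤ L) where

    On-fv : ∀ x φ {ρ σ} → On (Match a b) (fv (exF x φ)) ρ σ → On (Match a b) (fvQ x φ) ρ σ
    On-fv x φ match y∈ z∈ = match (fvQ⊆filter x φ y∈) (fvQ⊆filter x φ z∈)

    3*<L : ∀ {k} → k < s → k + (k + k) < L
    3*<L {k} k<s = ≤-trans (+-mono-≤ k<s (+-mono-≤ (<⇒≤ k<s) (<⇒≤ k<s))) 3s≤L

    -- Induction on the formula. The invariant is renewed at a quantifier of the first kind and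
    -- weakened to a partial isomorphism only in front of a quantifier-free body.
    transfer : ∀ φ {ρ σ} → Within s φ → On (Match a b) (fv φ) ρ σ →
               Sat (Spider a) ρ φ ⇔ Sat (Spider b) σ φ

    transferQ : ∀ x φ {ρ σ} → WithinQ s x φ → On (Match a b) (fv (exF x φ)) ρ σ →
      (Sat (Spider a) ρ (exF x φ) ⇔ Sat (Spider b) σ (exF x φ)) ×
      (Sat (Spider a) ρ (allF x φ) ⇔ Sat (Spider b) σ (allF x φ))

    step-transfer : ∀ x φ {ρ σ v w} → Within s φ → On (Match a b) (fvQ x φ) ρ σ →
      Extends a b (fvQ x φ) ρ σ v w →
      Sat (Spider a) (update ρ x v) φ ⇔ Sat (Spider b) (update σ x w) φ
    step-transfer x φ within match e = transfer φ within
      (On-update {R = Match a b} (λ {u} {u′} {v} {v′} → Match-sym a b {u} {u′} {v} {v′}) x φ match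
        (height-≡ e , height-≡ e , mk⇔ (λ _ → refl) (λ _ → refl)) (Extends⇒Match a b match e))

    last-transfer : ∀ x φ {ρ σ v w} → qdepth φ ≤ 0 → On (Match a b) (fvQ x φ) ρ σ →
      IsoTo a b (fvQ x φ) ρ σ v w →
      Sat (Spider a) (update ρ x v) φ ⇔ Sat (Spider b) (update σ x w) φ
    last-transfer x φ qf match iso = quantifier-free-transfer (Spider a) (Spider b) φ qf
      (On-update {R = Iso (Spider a) (Spider b)} (Iso-sym (Spider a) (Spider b)) x φ
        (λ y∈ z∈ → Match⇒Iso a b (match y∈ z∈)) (Iso-diagonal (Spider a) (Spider b)) iso)

    transfer (adjF x y) _ match = proj₂ (Match⇒Iso a b (match (here refl) (there (here refl))))
    transfer (eqF x y)  _ match = proj₁ (Match⇒Iso a b (match (here refl) (there (here refl))))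
    transfer (notF φ) within match = ¬-cong-⇔ (transfer φ within match)
    transfer (andF φ ψ) (wφ , wψ) match = ×-cong-⇔
      (transfer φ wφ λ y z → match (∈-++⁺ˡ y) (∈-++⁺ˡ z))
      (transfer ψ wψ λ y z → match (∈-++⁺ʳ (fv φ) y) (∈-++⁺ʳ (fv φ) z))
    transfer (orF φ ψ) (wφ , wψ) match = ⊎-cong-⇔
      (transfer φ wφ λ y z → match (∈-++⁺ˡ y) (∈-++⁺ˡ z))
      (transfer ψ wψ λ y z → match (∈-++⁺ʳ (fv φ) y) (∈-++⁺ʳ (fv φ) z))
    transfer (exF x φ)  within match = proj₁ (transferQ x φ within match)
    transfer (allF x φ) within match = proj₂ (transferQ x φ within match)

    transferQ x φ {ρ} {σ} (inj₁ (2+k≤s , within)) match = back-and-forth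
      (Extends a b (fvQ x φ) ρ σ) (step-transfer x φ within match′)
      (extend a b match′ (≤-pred (≤-trans 2+k≤s s≤1+b)))
      (λ w → let v , e = extend b a (On-flip a b match′) (≤-pred (≤-trans 2+k≤s s≤1+a)) w in v , Extends-flip e)
      where
      match′ : On (Match a b) (fvQ x φ) ρ σ
      match′ = On-fv x φ match
    transferQ x φ {ρ} {σ} (inj₂ (1+k≤s , qf)) match = back-and-forth
      (IsoTo a b (fvQ x φ) ρ σ) (last-transfer x φ qf match′)
      (extend-last a b match′ 1≤b (≤-pred (≤-trans 1+k≤s s≤1+b)) (3*<L 1+k≤s))
      (λ w → let v , e = extend-last b a (On-flip a b match′) 1≤a (≤-pred (≤-trans 1+k≤s s≤1+a)) (3*<L 1+k≤s) w
             in v , IsoTo-flip b a e)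
      where
      match′ : On (Match a b) (fvQ x φ) ρ σ
      match′ = On-fv x φ match

-- The spider with as many legs as the star has leaves contains the star, the one with a leg fewer
-- does not. A sentence starts with an empty board, where the invariant holds vacuously, so it
-- cannot tell them apart.
within⇒¬defines : ∀ {s} → 3 ≤ s → ∀ Φ → Sentence Φ → Within s Φ → ¬ DefinesAsympConn Φ (𝒞 (Star s))
within⇒¬defines {suc s} (s≤s 2≤s) Φ closed within (N , defines) =
  Spider-∌-Star s 2≤s ≤-refl (to (defines _ (Spider s) (Spider-connected s) (large s 1≤s)) H⊨Φ)
  where
  -- Here `s` is one less than the number of leaves. The summand `N` makes both spiders large
  -- enough; the rest leaves enough heights for the last round.
  L = N + (suc s + (suc s + suc s))
  open Spiders L
  1≤s = ≤-trans (s≤s z≤n) 2≤s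

  large : ∀ m → 1 ≤ m → N ≤ suc (m * L)
  large m 1≤m = m≤n⇒m≤1+n (≤-trans (m≤m+n N _) (≤-trans (≤-reflexive (≡.sym (*-identityˡ L))) (*-monoˡ-≤ L 1≤m)))

  G⊨Φ : Spider (suc s) ⊨ Φ
  G⊨Φ = from (defines _ (Spider (suc s)) (Spider-connected (suc s)) (large (suc s) (s≤s z≤n)))
          (Spider-∋-Star (suc s) (≤-trans (s≤s z≤n) (m≤n+m _ N)))

  H⊨Φ : Spider s ⊨ Φ
  H⊨Φ σ = to (transfer (suc s) s (s≤s z≤n) 1≤s (n≤1+n _) ≤-refl (m≤n+m _ N) Φ within
               λ y∈ → contradiction (subst (_ ∈_) closed y∈) λ ()) (G⊨Φ λ _ → zero)

-- The defining sentence

Contains-Star : ∀ {s n} (G : Graph n) c (z : Fin s → Fin n) → Injective _≡_ _≡_ z →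
                (∀ i → c ~ z i within G) → Contains (Star s) G
Contains-Star {s} {n} G c z z-inj c~z = f , f-injective , f-hom
  where
  f : Fin (suc s) → Fin n
  f zero    = c
  f (suc i) = z i
  c≢z : ∀ i → c ≢ z i
  c≢z i refl = contradiction (≡.trans (≡.sym (c~z i)) (irrefl G c)) λ ()
  f-injective : Injective _≡_ _≡_ f
  f-injective {zero}  {zero}  _  = refl
  f-injective {zero}  {suc j} eq = contradiction eq (c≢z j)
  f-injective {suc i} {zero}  eq = contradiction (≡.sym eq) (c≢z i)
  f-injective {suc i} {suc j} eq = cong suc (z-inj eq)
  f-hom : ∀ u v → u ~ v within Star s → f u ~ f v within G
  f-hom zero    (suc j) _ = c~z j
  f-hom (suc i) zero    _ = ≡.trans (sym G (z i) c) (c~z i)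

-- Serves a vertex known to have `s` - 1 neighbours in a family of `s`: its neighbour `d` outside
-- the family takes the place of `z j` as a leaf.
Contains-Star-replacing : ∀ {s n} (G : Graph n) c d (z : Fin s → Fin n) j → Injective _≡_ _≡_ z →
  (∀ i → i ≢ j → c ~ z i within G) → c ~ d within G → (∀ i → d ≢ z i) → Contains (Star s) G
Contains-Star-replacing {s} {n} G c d z j z-inj c~z c~d d≢z = Contains-Star G c z′ z′-injective c~z′
  where
  z′ : Fin s → Fin n
  z′ i with i Fin.≟ j
  ... | yes _ = d
  ... | no  _ = z i
  z′-injective : Injective _≡_ _≡_ z′
  z′-injective {i} {k} eq with i Fin.≟ j | k Fin.≟ j
  ... | yes p | yes q = ≡.trans p (≡.sym q)
  ... | yes _ | no  _ = contradiction eq (d≢z k)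
  ... | no  _ | yes _ = contradiction (≡.sym eq) (d≢z i)
  ... | no  _ | no  _ = z-inj eq
  c~z′ : ∀ i → c ~ z′ i within G
  c~z′ i with i Fin.≟ j
  ... | yes _  = c~d
  ... | no i≢j = c~z i i≢j

-- Follow the path up to its first edge that leaves `P`.
boundary-edge : ∀ {n} {G : Graph n} {P : Fin n → Set} → (∀ u → Dec (P u)) →
  ∀ {u v} → Reach G u v → P u → ¬ P v → ∃[ a ] ∃[ b ] a ~ b within G × P a × ¬ P b
boundary-edge P? here Pu ¬Pv = contradiction Pu ¬Pv
boundary-edge P? (step {u} {w} u~w w⇝v) Pu ¬Pv with P? w
... | yes Pw = boundary-edge P? w⇝v Pw ¬Pv
... | no ¬Pw = u , w , u~w , Pu , ¬Pw

-- If the x i are not distinct, one of them is adjacent to every y j; otherwise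
-- the x i and y j already have s − 1 neighbours each among themselves, and
-- connectedness gives one of them another.
crown⇒Star : ∀ {s n} (G : Graph n) → Connected G → 1 ≤ s → s + s < n → (x y : Fin s → Fin n) →
  Injective _≡_ _≡_ y → (∀ i j → i ≢ j → x i ~ y j within G) → Contains (Star s) G
crown⇒Star {s} {n} G (_ , reach) 1≤s 2s<n x y y-inj x~y
  with Fin.any? (λ i → Fin.any? (λ j → ¬? (i Fin.≟ j) ×-dec (x i Fin.≟ x j)))
... | yes (i , j , i≢j , xi≡xj) = Contains-Star G (x i) y y-inj adjacent
  where
  adjacent : ∀ k → x i ~ y k within G
  adjacent k with i Fin.≟ k
  -- The hypothesis says nothing about `x i` and `y i`, but `x j` is the same vertex as `x i` and is
  -- adjacent to `y i`.
  ... | yes refl = subst (λ c → c ~ y k within G) (≡.sym xi≡xj) (x~y j k (i≢j ∘ ≡.sym))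
  ... | no  i≢k  = x~y i k i≢k
... | no ¬collision = conclude (boundary-edge P? (reach (y i₀) v) (inj₂ (i₀ , refl)) ¬Pv)
  where
  x-inj : Injective _≡_ _≡_ x
  x-inj {i} {j} eq with i Fin.≟ j
  ... | yes i≡j = i≡j
  ... | no  i≢j = contradiction (i , j , i≢j , eq) ¬collision

  P : Fin n → Set
  P u = (∃[ i ] x i ≡ u) ⊎ (∃[ j ] y j ≡ u)
  P? : ∀ u → Dec (P u)
  P? u = Fin.any? (λ i → x i Fin.≟ u) ⊎-dec Fin.any? (λ j → y j Fin.≟ u)

  i₀ = fromℕ< 1≤s
  xy = tabulate x ++ tabulate y
  |xy| : length xy ≡ s + s
  |xy| = ≡.trans (length-++ (tabulate x)) (cong₂ _+_ (length-tabulate x) (length-tabulate y))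
  -- The crown has at most 2`s` vertices and the graph more, so some vertex lies outside and every
  -- path to it leaves the crown.
  fresh = ∃-fresh Fin._≟_ id id xy (subst (_< n) (≡.sym |xy|) 2s<n)
  v = proj₁ fresh
  ¬Pv : ¬ P v
  ¬Pv (inj₁ (i , eq)) = proj₂ fresh (∈-++⁺ˡ (subst (_∈ tabulate x) eq (∈-tabulate⁺ i)))
  ¬Pv (inj₂ (j , eq)) = proj₂ fresh (∈-++⁺ʳ (tabulate x) (subst (_∈ tabulate y) eq (∈-tabulate⁺ j)))

  conclude : (∃[ a ] ∃[ b ] a ~ b within G × P a × ¬ P b) → Contains (Star s) G
  conclude (_ , b , a~b , inj₁ (i , refl) , ¬Pb) = Contains-Star-replacing G (x i) b y i y-inj
    (λ j j≢i → x~y i j (j≢i ∘ ≡.sym)) a~b (λ j eq → ¬Pb (inj₂ (j , ≡.sym eq)))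
  conclude (_ , b , a~b , inj₂ (j , refl) , ¬Pb) = Contains-Star-replacing G (y j) b x j x-inj
    (λ i i≢j → ≡.trans (sym G (y j) (x i)) (x~y i j i≢j)) a~b (λ i eq → ¬Pb (inj₁ (i , ≡.sym eq)))

-- The language has no constant for truth, hence the trivial equation.
⋀ : List Formula → Formula
⋀ []       = eqF 0 0
⋀ (φ ∷ φs) = andF φ (⋀ φs)

module _ {n} (G : Graph n) where

  ⋀⁺ : ∀ {ρ φs} → All (Sat G ρ) φs → Sat G ρ (⋀ φs)
  ⋀⁺ []       = refl
  ⋀⁺ (p ∷ ps) = p , ⋀⁺ ps

  ⋀⁻ : ∀ {ρ} φs → Sat G ρ (⋀ φs) → All (Sat G ρ) φs
  ⋀⁻ []       _        = []
  ⋀⁻ (φ ∷ φs) (p , ps) = p ∷ ⋀⁻ φs ps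

qdepth-⋀-map : ∀ {k} (f : Var → Formula) xs → (∀ i → qdepth (f i) ≤ k) → qdepth (⋀ (map f xs)) ≤ k
qdepth-⋀-map f []       ≤k = z≤n
qdepth-⋀-map f (x ∷ xs) ≤k = ⊔-lub (≤k x) (qdepth-⋀-map f xs ≤k)

vars-⋀ : ∀ {k φs} → 0 < k → All (λ φ → All (_< k) (vars φ)) φs → All (_< k) (vars (⋀ φs))
vars-⋀ 0<k []       = 0<k ∷ 0<k ∷ []
vars-⋀ 0<k (p ∷ ps) = All.++⁺ p (vars-⋀ 0<k ps)

∃* : ℕ → Formula → Formula
∃* zero    φ = φ
∃* (suc k) φ = ∃* k (exF k φ)

module _ {n} (G : Graph n) where

  -- The block binds only the variables below `k`, so the matrix is asked under every assignment
  -- that agrees with `f` there.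
  ∃*⁺ : ∀ k φ (f : Var → Fin n) → (∀ ρ → (∀ {j} → j < k → ρ j ≡ f j) → Sat G ρ φ) → ∀ ρ → Sat G ρ (∃* k φ)
  ∃*⁺ zero    φ f sat ρ = sat ρ λ ()
  ∃*⁺ (suc k) φ f sat = ∃*⁺ k (exF k φ) f λ ρ agree → f k , sat (update ρ k (f k)) (agree′ ρ agree)
    where
    agree′ : ∀ ρ → (∀ {j} → j < k → ρ j ≡ f j) → ∀ {j} → j < suc k → update ρ k (f k) j ≡ f j
    agree′ ρ agree {j} j<1+k with k ≟ j
    ... | yes refl = update-≡ ρ k (f k)
    ... | no  k≢j  = ≡.trans (update-≢ ρ (f k) k≢j) (agree (≤∧≢⇒< (≤-pred j<1+k) (k≢j ∘ ≡.sym)))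

  ∃*⁻ : ∀ k φ {ρ} → Sat G ρ (∃* k φ) → ∃[ ρ′ ] Sat G ρ′ φ
  ∃*⁻ zero    φ sat = _ , sat
  ∃*⁻ (suc k) φ sat = let _ , _ , sat′ = ∃*⁻ k (exF k φ) sat in _ , sat′

qdepth-∃* : ∀ k φ → qdepth (∃* k φ) ≡ k + qdepth φ
qdepth-∃* zero    φ = refl
qdepth-∃* (suc k) φ = ≡.trans (qdepth-∃* k (exF k φ)) (+-suc k (qdepth φ))

vars-∃* : ∀ {s} k φ → k ≤ s → All (_< s) (vars φ) → All (_< s) (vars (∃* k φ))
vars-∃* zero    φ _   p = p
vars-∃* (suc k) φ k<s p = vars-∃* k (exF k φ) (<⇒≤ k<s) (k<s ∷ p)

∃*-closed : ∀ k φ → All (_< k) (fv φ) → Sentence (∃* k φ)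
∃*-closed zero φ p with fv φ | p
... | [] | [] = refl
∃*-closed (suc k) φ p = ∃*-closed k (exF k φ) (All.tabulate λ y∈ →
  let y∈φ , k≢y = ∈-filter⁻ (λ y → ¬? (k ≟ y)) {xs = fv φ} y∈
  in ≤∧≢⇒< (≤-pred (All.lookup p y∈φ)) (k≢y ∘ ≡.sym))

-- The star sentence, its resources and its correctness

module _ (s : ℕ) where

  others : Var → List Var
  others i = filter (λ j → ¬? (i ≟ j)) (upTo s)

  ∈-others : ∀ {i j} → j < s → i ≢ j → j ∈ others i
  ∈-others j<s i≢j = ∈-filter⁺ (λ j → ¬? (_ ≟ j)) (∈-upTo⁺ j<s) i≢j

  ∈-others⁻ : ∀ {i j} → j ∈ others i → j < s × i ≢ j
  ∈-others⁻ j∈ = let j∈upTo , i≢j = ∈-filter⁻ (λ j → ¬? (_ ≟ j)) {xs = upTo s} j∈ in ∈-upTo⁻ j∈upTo , i≢j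

  -- `joined i` is evaluated after `i` has been rebound to the common neighbour; since `others i`
  -- omits `i`, the overwritten vertex is not mentioned in that scope.
  distinct joined clause : Var → Formula
  distinct i = ⋀ (map (λ j → notF (eqF i j)) (others i))
  joined   i = ⋀ (map (adjF i) (others i))
  clause   i = andF (distinct i) (exF i (joined i))

  matrix : Formula
  matrix = ⋀ (map clause (upTo s))

  -- ∃y₀…yₛ₋₁ distinct such that any s − 1 of them have a common neighbour;
  -- the neighbour of all but yᵢ is called yᵢ again, which saves a variable.
  starSentence : Formula
  starSentence = ∃* s matrix

  qdepth-starSentence : qdepth starSentence ≤ suc s
  qdepth-starSentence = ≤-trans (≤-reflexive (qdepth-∃* s matrix))
    (≤-trans (+-monoʳ-≤ s (qdepth-⋀-map clause (upTo s) λ i → ⊔-lub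
      (≤-trans (qdepth-⋀-map (λ j → notF (eqF i j)) (others i) λ _ → z≤n) z≤n)
      (s≤s (qdepth-⋀-map (adjF i) (others i) λ _ → z≤n))))
    (≤-reflexive (+-comm s 1)))

  module _ (0<s : 0 < s) where

    vars-matrix : All (_< s) (vars matrix)
    vars-matrix = vars-⋀ 0<s (All.map⁺ (All.tabulate λ {i} i∈ → let i<s = ∈-upTo⁻ i∈ in All.++⁺
      (vars-⋀ 0<s (All.map⁺ (All.tabulate λ j∈ → i<s ∷ proj₁ (∈-others⁻ {i} j∈) ∷ [])))
      (i<s ∷ vars-⋀ 0<s (All.map⁺ (All.tabulate λ j∈ → i<s ∷ proj₁ (∈-others⁻ {i} j∈) ∷ [])))))

    starSentence-closed : Sentence starSentence
    starSentence-closed = ∃*-closed s matrix (All.tabulate λ y∈ → All.lookup vars-matrix (fv⊆vars matrix y∈))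

    width-starSentence : width starSentence ≤ s
    width-starSentence = ≤-trans
      (unique-⊆⇒length≤ (Unique.deduplicate-! _≟_ _) λ y∈ →
        ∈-upTo⁺ (All.lookup (vars-∃* s _ ≤-refl vars-matrix) (∈-deduplicate⁻ _≟_ (vars starSentence) y∈)))
      (≤-reflexive (length-upTo s))

    -- The values of the variables and the common neighbours chosen in the clauses form a crown in a
    -- graph too large to be exhausted by it.
    starSentence-sound : ∀ {n} (G : Graph n) → Connected G → s + s < n → G ⊨ starSentence → Contains (Star s) G
    starSentence-sound {n} G conn@(1≤n , _) 2s<n G⊨ =
      crown⇒Star G conn 0<s 2s<n (λ i → x (Fin.toℕ<n i)) (ρ ∘ toℕ) y-inj
        (λ i j i≢j → x~ (Fin.toℕ<n i) (Fin.toℕ<n j) (i≢j ∘ Fin.toℕ-injective))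
      where
      valuation = ∃*⁻ G s matrix (G⊨ λ _ → fromℕ< 1≤n)
      ρ = proj₁ valuation
      holds : ∀ {i} → i < s → Sat G ρ (clause i)
      holds i<s = All.lookup (All.map⁻ (⋀⁻ G _ (proj₂ valuation))) (∈-upTo⁺ i<s)
      x : ∀ {i} → i < s → Fin n
      x i<s = proj₁ (proj₂ (holds i<s))
      x~ : ∀ {i j} (i<s : i < s) → j < s → i ≢ j → x i<s ~ ρ j within G
      -- Under the rebinding, `i` denotes the common neighbour while `j` keeps its value.
      x~ {i} i<s j<s i≢j = ≡.subst₂ (λ u v → u ~ v within G) (update-≡ ρ i _) (update-≢ ρ _ i≢j)
        (All.lookup (All.map⁻ (⋀⁻ G _ (proj₂ (proj₂ (holds i<s))))) (∈-others j<s i≢j))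
      y-inj : Injective _≡_ _≡_ (ρ ∘ toℕ)
      y-inj {i} {j} eq with i Fin.≟ j
      ... | yes i≡j = i≡j
      ... | no  i≢j = contradiction eq (All.lookup (All.map⁻ (⋀⁻ G _ (proj₁ (holds (Fin.toℕ<n i)))))
                        (∈-others (Fin.toℕ<n j) (i≢j ∘ Fin.toℕ-injective)))

    -- The leaves interpret the variables, and the centre of the star is the common neighbour in
    -- every clause.
    starSentence-complete : ∀ {n} (G : Graph n) → Contains (Star s) G → G ⊨ starSentence
    starSentence-complete {n} G (h , h-inj , h-hom) = ∃*⁺ G s _ f λ ρ agree →
      ⋀⁺ G (All.map⁺ (All.tabulate λ {i} i∈ → let i<s = ∈-upTo⁻ i∈ in
        ⋀⁺ G (All.map⁺ (All.tabulate λ j∈ eq → let j<s , i≢j = ∈-others⁻ {i} j∈ in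
          i≢j (f-inj i<s j<s (≡.trans (≡.sym (agree i<s)) (≡.trans eq (agree j<s)))))) ,
        h zero ,
        ⋀⁺ G (All.map⁺ (All.tabulate λ j∈ → let j<s , i≢j = ∈-others⁻ {i} j∈ in
          ≡.subst₂ (λ u v → u ~ v within G) (≡.sym (update-≡ ρ i _))
            (≡.sym (≡.trans (update-≢ ρ _ i≢j) (agree j<s))) (c~f j<s)))))
      where
      -- Assignments are total, so indices from `s` on receive the centre as a filler.
      f : Var → Fin n
      f j with j <? s
      ... | yes j<s = h (suc (fromℕ< j<s))
      ... | no  _   = h zero
      f≡ : ∀ {j} (j<s : j < s) → f j ≡ h (suc (fromℕ< j<s))
      f≡ {j} j<s with j <? s
      ... | yes _   = refl
      ... | no  j≮s = contradiction j<s j≮s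
      f-inj : ∀ {i j} → i < s → j < s → f i ≡ f j → i ≡ j
      f-inj i<s j<s eq = Fin.fromℕ<-injective _ _ i<s j<s
        (Fin.suc-injective (h-inj (≡.trans (≡.sym (f≡ i<s)) (≡.trans eq (f≡ j<s)))))
      c~f : ∀ {j} → j < s → h zero ~ f j within G
      c~f j<s = subst (λ v → h zero ~ v within G) (≡.sym (f≡ j<s)) (h-hom zero (suc (fromℕ< j<s)) refl)

    starSentence-defines : DefinesAsympConn starSentence (𝒞 (Star s))
    -- The threshold excludes graphs consisting of a crown alone, which has at most 2`s` vertices.
    starSentence-defines = suc (s + s) , λ n G conn large →
      mk⇔ (starSentence-sound G conn large) (starSentence-complete G)

theorem3 : (s : ℕ) → 3 ≤ s → D′≡ (Star s) (suc s) × W′≡ (Star s) s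
theorem3 s 3≤s =
  -- The sentence comes with upper bounds only; the lower bounds, applied to it, turn them into
  -- equalities.
  ((Φ , closed , defines , ≤-antisym (qdepth-starSentence s) (depth≥ Φ closed defines)) , depth≥) ,
  ((Φ , closed , defines , ≤-antisym (width-starSentence s 0<s) (width≥ Φ closed defines)) , width≥)
  where
  0<s = ≤-trans (s≤s z≤n) 3≤s
  Φ = starSentence s
  closed = starSentence-closed s 0<s
  defines = starSentence-defines s 0<s

  depth≥ : ∀ Φ → Sentence Φ → DefinesAsympConn Φ (𝒞 (Star s)) → suc s ≤ qdepth Φ
  depth≥ Φ closed defines = ≰⇒> λ ≤s → within⇒¬defines 3≤s Φ closed
    (qdepth⇒within Φ [] (subst (_ ∈_) closed) ≤s) defines

  width≥ : ∀ Φ → Sentence Φ → DefinesAsympConn Φ (𝒞 (Star s)) → s ≤ width Φ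
  width≥ Φ closed defines = ≮⇒≥ λ <s → within⇒¬defines 3≤s Φ closed
    (width⇒within (deduplicate _≟_ (vars Φ)) <s Φ (∈-deduplicate⁺ _≟_)) defines
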